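{- For every $k,\ell\ge1$, $\mathsf{RT}^2_{k,\ell}\le_c\mathsf{DT}^2_{2k,2\ell+1}$.
   Context: $\mathsf{RT}^2_{k,\ell}$: instances are colorings $f:[\mathbb N]^2\to k$; solutions are infinite sets $H\subseteq\mathbb N$ with $|f([H]^2)|\le\ell$. $\mathsf{DT}^2_{k,\ell}$: instances are colorings $f:[\mathbb Q]^2\to k$ (with $\mathbb Q$ computably presented); solutions are sets $S\subseteq\mathbb Q$ such that $(S,<)$ is a dense linear order without endpoints and $|f([S]^2)|\le\ell$. Computable reducibility: a problem $\mathsf Q$ is computably reducible to $\mathsf P$, written $\mathsf Q\le_c\mathsf P$, if every $\mathsf Q$-instance $X$ computes a $\mathsf P$-instance $\widehat X$ such that for every $\mathsf P$-solution $\widehat Y$ to $\widehat X$, $X\oplus\widehat Y$ computes a $\mathsf Q$-solution to $X$. -}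

module Defs where

open import Data.Bool using (Bool; T; if_then_else_)
open import Data.Fin using (Fin; toℕ)
open import Data.Fin.Subset using (Subset; _∈_; ∣_∣)
open import Data.Nat using (ℕ; zero; suc; _≤_; _<_; z<s)
import Data.Nat.Properties as ℕₚ
open import Data.Product using (Σ; Σ-syntax; ∃-syntax; _×_; _,_; proj₁)
open import Data.Rational using (ℚ) renaming (_<_ to _<ℚ_)
import Data.Rational.Properties as ℚₚ
open import Data.Vec using (Vec; []; _∷_; lookup)
open import Function using (_∘_; _on_)
open import Function.Bundles using (_⤖_; module Bijection)
open import Level using (0ℓ)
open import Relation.Binary using (Rel; Trichotomous; tri<; tri≈; tri>; IsDenseLinearOrder)
open import Relation.Binary.PropositionalEquality using (_≡_; _≢_; refl; trans; cong)
open import Relation.Nullary using (yes; no; does; contradiction; recompute)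
open import Relation.Nullary.Negation using (contradiction-irr)
open import Relation.Unary using (Pred)

-- Oracle computability: μ-recursive functions relative to A : ℕ → ℕ.

data Code : ℕ → Set where
  zer    : Code 0
  succ   : Code 1
  oracle : Code 1
  proj   : ∀ {n} → Fin n → Code n
  comp   : ∀ {m n} → Code m → Vec (Code n) m → Code n
  prec   : ∀ {n} → Code n → Code (suc (suc n)) → Code (suc n)
  mu     : ∀ {n} → Code (suc n) → Code n

infix 4 _⊢_[_]⇓_

-- A ⊢ e [ xs ]⇓ y : the program e with oracle A halts on xs with output y.
data _⊢_[_]⇓_ (A : ℕ → ℕ) : ∀ {n} → Code n → Vec ℕ n → ℕ → Set where
  zer⇓    : A ⊢ zer [ [] ]⇓ 0
  succ⇓   : ∀ {x} → A ⊢ succ [ x ∷ [] ]⇓ suc x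
  oracle⇓ : ∀ {x} → A ⊢ oracle [ x ∷ [] ]⇓ A x
  proj⇓   : ∀ {n} {i : Fin n} {xs} → A ⊢ proj i [ xs ]⇓ lookup xs i
  comp⇓   : ∀ {m n} {f : Code m} {gs : Vec (Code n) m} {xs ys z} →
            (∀ i → A ⊢ lookup gs i [ xs ]⇓ lookup ys i) →
            A ⊢ f [ ys ]⇓ z → A ⊢ comp f gs [ xs ]⇓ z
  prec0⇓  : ∀ {n} {f : Code n} {g xs y} →
            A ⊢ f [ xs ]⇓ y → A ⊢ prec f g [ 0 ∷ xs ]⇓ y
  precs⇓  : ∀ {n} {f : Code n} {g x xs y z} →
            A ⊢ prec f g [ x ∷ xs ]⇓ y →
            A ⊢ g [ x ∷ y ∷ xs ]⇓ z → A ⊢ prec f g [ suc x ∷ xs ]⇓ z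
  mu⇓     : ∀ {n} {f : Code (suc n)} {xs y} →
            A ⊢ f [ y ∷ xs ]⇓ 0 →
            (∀ z → z < y → ∃[ w ] A ⊢ f [ z ∷ xs ]⇓ suc w) →
            A ⊢ mu f [ xs ]⇓ y

infix 4 _≤T_ _≤c_
infixr 5 _⊕_

_≤T_ : (ℕ → ℕ) → (ℕ → ℕ) → Set
B ≤T A = Σ[ e ∈ Code 1 ] ∀ n → A ⊢ e [ n ∷ [] ]⇓ B n

-- (A ⊕ B)(2n) = A(n) and (A ⊕ B)(2n+1) = B(n).
_⊕_ : (ℕ → ℕ) → (ℕ → ℕ) → ℕ → ℕ
(A ⊕ B) zero          = A 0
(A ⊕ B) (suc zero)    = B 0
(A ⊕ B) (suc (suc n)) = ((A ∘ suc) ⊕ (B ∘ suc)) n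

bit : Bool → ℕ
bit b = if b then 1 else 0

-- The representations fix the elements of Baire space that stand for instances
-- and solutions in computations.
record Problem : Set₁ where
  field
    Instance : Set
    Solution : Set
    _solves_ : Solution → Instance → Set
    repI     : Instance → ℕ → ℕ
    repS     : Solution → ℕ → ℕ

_≤c_ : Problem → Problem → Set
Q ≤c P =
  ∀ (X : Q.Instance) → Σ[ X̂ ∈ P.Instance ]
    (P.repI X̂ ≤T Q.repI X) ×
    (∀ (Ŷ : P.Solution) → Ŷ P.solves X̂ →
      Σ[ Y ∈ Q.Solution ] (Y Q.solves X) × (Q.repS Y ≤T (Q.repI X ⊕ P.repS Ŷ)))
  where
  module Q = Problem Q
  module P = Problem P

-- [ A ]², for A linearly ordered by _≺_: an unordered pair is listed increasingly.
record Pairs {A : Set} (_≺_ : Rel A 0ℓ) : Set where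
  constructor pair
  field
    lo     : A
    hi     : A
    .lo≺hi : lo ≺ hi

open Pairs public using (lo; hi)

unordered : {A : Set} {_≺_ : Rel A 0ℓ} → Trichotomous _≡_ _≺_ →
            (x y : A) → .(x ≢ y) → Pairs _≺_
unordered cmp x y x≢y with cmp x y
... | tri< x≺y _ _ = pair x y x≺y
... | tri≈ _ x≡y _ = contradiction-irr x≢y (λ x≢y′ → x≢y′ x≡y)
... | tri> _ _ y≺x = pair y x y≺x

Image : {A : Set} {_≺_ : Rel A 0ℓ} {k : ℕ} →
        (Pairs _≺_ → Fin k) → (A → Bool) → Pred (Fin k) 0ℓ
Image f H c = ∃[ p ] T (H (lo p)) × T (H (hi p)) × f p ≡ c

-- Cardinality at most ℓ, as containment in a (decidable) set of at most ℓ
-- colours; exact images of f need not be decidable.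
Card≤ : {k : ℕ} → Pred (Fin k) 0ℓ → ℕ → Set
Card≤ {k} P ℓ = Σ[ C ∈ Subset k ] (∣ C ∣ ≤ ℓ) × (∀ c → P c → c ∈ C)

-- The enumeration {0,1}, {0,2}, {1,2}, {0,3}, {1,3}, {2,3}, … of [ℕ]².
next : Pairs _<_ → Pairs _<_
next (pair x y _) with suc x ℕₚ.<? y
... | yes sx<y = pair (suc x) y sx<y
... | no  _    = pair 0 (suc y) z<s

pairAt : ℕ → Pairs _<_
pairAt zero    = pair 0 1 z<s
pairAt (suc n) = next (pairAt n)

pairAt-surjective : ∀ p → ∃[ n ] pairAt n ≡ p
pairAt-surjective (pair x y x<y) = go x y (recompute (x ℕₚ.<? y) x<y)
  where
  next-step : ∀ x y .(x<y : x < y) (sx<y : suc x < y) →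
              next (pair x y x<y) ≡ pair (suc x) y sx<y
  next-step x y x<y sx<y with suc x ℕₚ.<? y
  ... | yes _   = refl
  ... | no  sx≮ = contradiction sx<y sx≮

  next-wrap : ∀ x → next (pair x (suc x) (ℕₚ.n<1+n x)) ≡ pair 0 (suc (suc x)) z<s
  next-wrap x with suc x ℕₚ.<? suc x
  ... | yes sx<sx = contradiction sx<sx (ℕₚ.<-irrefl refl)
  ... | no  _     = refl

  go : ∀ x y (x<y : x < y) → ∃[ n ] pairAt n ≡ pair x y x<y
  go zero    (suc zero)    _    = 0 , refl
  go zero    (suc (suc y)) _    =
    let n , eq = go y (suc y) (ℕₚ.n<1+n y)
    in suc n , trans (cong next eq) (next-wrap y)
  go (suc x) y             sx<y =
    let x<y    = ℕₚ.<-trans (ℕₚ.n<1+n x) sx<y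
        n , eq = go x y x<y
    in suc n , trans (cong next eq) (next-step x y x<y sx<y)

Infinite : (ℕ → Bool) → Set
Infinite H = ∀ n → ∃[ m ] n ≤ m × T (H m)

RT² : ℕ → ℕ → Problem
RT² k ℓ = record
  { Instance = Pairs _<_ → Fin k
  ; Solution = ℕ → Bool
  ; _solves_ = λ H f → Infinite H × Card≤ (Image f H) ℓ
  ; repI     = λ f n → toℕ (f (pairAt n))
  ; repS     = λ H n → bit (H n)
  }

-- A computable copy of (ℚ, <) with domain ℕ; "computable" is relative to the
-- constant zero oracle.
record ComputablePresentation : Set where
  field
    enum         : ℕ ⤖ ℚ
    <-computable : Σ[ e ∈ Code 2 ] ∀ i j →
      (λ _ → 0) ⊢ e [ i ∷ j ∷ [] ]⇓
        bit (does (Bijection.to enum i ℚₚ.<? Bijection.to enum j))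

  ν : ℕ → ℚ
  ν = Bijection.to enum

  ν-pair : Pairs _<_ → Pairs _<ℚ_
  ν-pair (pair i j i<j) =
    unordered ℚₚ.<-cmp (ν i) (ν j) (λ νi≡νj → ℕₚ.<⇒≢ i<j (Bijection.injective enum νi≡νj))

Members : (ℚ → Bool) → Set
Members S = Σ[ q ∈ ℚ ] T (S q)

-- As usual for linear orders without endpoints, the empty order is excluded.
record DenseWithoutEndpoints (S : ℚ → Bool) : Set where
  _≺_ : Rel (Members S) 0ℓ
  _≺_ = _<ℚ_ on proj₁

  field
    isDenseLinearOrder : IsDenseLinearOrder (_≡_ on proj₁) _≺_
    nonempty           : Members S
    noLeast            : ∀ x → ∃[ y ] y ≺ x
    noGreatest         : ∀ x → ∃[ y ] x ≺ y

DT² : ComputablePresentation → ℕ → ℕ → Problem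
DT² 𝒬 k ℓ = record
  { Instance = Pairs _<ℚ_ → Fin k
  ; Solution = ℚ → Bool
  ; _solves_ = λ S f → DenseWithoutEndpoints S × Card≤ (Image f S) ℓ
  ; repI     = λ f n → toℕ (f (ν-pair (pairAt n)))
  ; repS     = λ S n → bit (S (ν n))
  }
  where open ComputablePresentation 𝒬

{-# OPTIONS --safe #-}

-- Colour a pair of rationals ν i, ν j with i < j by f(i , j) together with the
-- bit telling whether ν i < ν j.  If a dense set S uses at most 2ℓ + 1 of these
-- colours, then one value of the bit occurs with at most ℓ values of f.  The
-- indices at which S attains a new maximum (or a new minimum, for the other
-- value of the bit) form an infinite set, computable from S, all of whose
-- pairs have that bit.

module Submission where

open import Defs
open import Data.Bool using (Bool; true; false; T; not; _∧_; if_then_else_)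
open import Data.Bool.Properties using (T-≡; T-∧)
open import Data.Fin using (Fin; zero; suc; toℕ; combine; _↑ˡ_)
open import Data.Fin.Patterns using (0F; 1F; 2F)
open import Data.Fin.Properties using (toℕ-combine)
open import Data.Fin.Subset using (Subset; _∈_; ∣_∣)
open import Data.Nat using (ℕ; zero; suc; pred; _≤_; _<_; _+_; _*_; _∸_)
import Data.Nat.Properties as ℕₚ
open import Data.Product using (Σ-syntax; ∃-syntax; _×_; _,_; proj₁; proj₂)
open import Data.Rational using (ℚ) renaming (_<_ to _<ℚ_)
import Data.Rational.Properties as ℚₚ
open import Data.Sum using (_⊎_; inj₁; inj₂)
open import Data.Vec using (Vec; []; _∷_; _++_; lookup; splitAt)
open import Data.Vec.Properties using (lookup-++ˡ; lookup-++ʳ; []=⇒lookup; lookup⇒[]=)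
open import Function using (_∘_; flip; _on_)
open import Function.Bundles using (module Bijection; module Equivalence)
open import Level using (0ℓ)
open import Relation.Binary using (Rel; Trichotomous; Decidable; tri<; tri≈; tri>)
open import Relation.Binary.PropositionalEquality using (_≡_; _≢_; refl; sym; trans; cong; cong₂; subst; module ≡-Reasoning)
open import Relation.Nullary using (¬_; yes; no; does; contradiction; recompute)
open import Relation.Nullary.Decidable using (dec-true; dec-false)

-- Oracle computability

Computable : (A : ℕ → ℕ) {n : ℕ} → (Vec ℕ n → ℕ) → Set
Computable A {n} F = Σ[ e ∈ Code n ] ∀ xs → A ⊢ e [ xs ]⇓ F xs

Computable₂ : (A : ℕ → ℕ) → (ℕ → ℕ → ℕ) → Set
Computable₂ A f = Σ[ e ∈ Code 2 ] ∀ x y → A ⊢ e [ x ∷ y ∷ [] ]⇓ f x y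

module _ {A : ℕ → ℕ} where

  unary : ∀ {f : ℕ → ℕ} {F} → Computable A F → (∀ x → F (x ∷ []) ≡ f x) → f ≤T A
  unary (e , d) eq = e , λ x → subst (A ⊢ e [ _ ]⇓_) (eq x) (d (x ∷ []))

  binary : ∀ {f : ℕ → ℕ → ℕ} {F} → Computable A F → (∀ x y → F (x ∷ y ∷ []) ≡ f x y) →
           Computable₂ A f
  binary (e , d) eq = e , λ x y → subst (A ⊢ e [ _ ]⇓_) (eq x y) (d (x ∷ y ∷ []))

  var : ∀ {n} (i : Fin n) → Computable A (λ xs → lookup xs i)
  var i = proj i , λ _ → proj⇓

  ap₁ : ∀ {n f} {G : Vec ℕ n → ℕ} → f ≤T A → Computable A G → Computable A (λ xs → f (G xs))
  ap₁ (e , d) (e₁ , d₁) = comp e (e₁ ∷ []) , λ xs →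
    comp⇓ {ys = _ ∷ []} (λ { 0F → d₁ xs }) (d _)

  ap₂ : ∀ {n f} {G H : Vec ℕ n → ℕ} → Computable₂ A f → Computable A G → Computable A H →
        Computable A (λ xs → f (G xs) (H xs))
  ap₂ (e , d) (e₁ , d₁) (e₂ , d₂) = comp e (e₁ ∷ e₂ ∷ []) , λ xs →
    comp⇓ {ys = _ ∷ _ ∷ []} (λ { 0F → d₁ xs ; 1F → d₂ xs }) (d _ _)

  suc-computable : suc ≤T A
  suc-computable = succ , λ _ → succ⇓

  const-computable : ∀ {n} c → Computable A {n} (λ _ → c)
  const-computable zero    = comp zer [] , λ _ → comp⇓ {ys = []} (λ ()) zer⇓
  const-computable (suc c) = ap₁ suc-computable (const-computable c)

  -- The step `s` has to be right only at the true previous value `r x`. This lets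
  -- `hi-pairAt-computable` rely on an invariant of the enumeration.
  primrec₁ : ∀ {r : ℕ → ℕ} {s} → Computable A s →
             (∀ x → s (x ∷ r x ∷ []) ≡ r (suc x)) → r ≤T A
  primrec₁ {r} (g , d) eq = prec (proj₁ (const-computable (r 0))) g , go
    where
    go : ∀ x → A ⊢ prec _ g [ x ∷ [] ]⇓ r x
    go zero    = prec0⇓ (proj₂ (const-computable (r 0)) [])
    go (suc x) = precs⇓ (go x) (subst (A ⊢ g [ _ ]⇓_) (eq x) (d _))

  primrec₂ : ∀ {r : ℕ → ℕ → ℕ} {s} → r 0 ≤T A → Computable A s →
             (∀ x y → s (x ∷ r x y ∷ y ∷ []) ≡ r (suc x) y) → Computable₂ A r
  primrec₂ {r} (f , c) (g , d) eq = prec f g , go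
    where
    go : ∀ x y → A ⊢ prec f g [ x ∷ y ∷ [] ]⇓ r x y
    go zero    y = prec0⇓ (c y)
    go (suc x) y = precs⇓ (go x y) (subst (A ⊢ g [ _ ]⇓_) (eq x y) (d _))

  +-computable : Computable₂ A _+_
  +-computable = primrec₂ (unary (var 0F) λ _ → refl) (ap₁ suc-computable (var 1F)) λ _ _ → refl

  *-computable : Computable₂ A _*_
  *-computable = primrec₂ (unary (const-computable 0) λ _ → refl)
    (ap₂ +-computable (var 2F) (var 1F)) λ _ _ → refl

  pred-computable : pred ≤T A
  pred-computable = primrec₁ (var 0F) λ _ → refl

  flip-computable : ∀ {f} → Computable₂ A f → Computable₂ A (flip f)
  flip-computable c = binary (ap₂ c (var 1F) (var 0F)) λ _ _ → refl

  ∸-computable : Computable₂ A _∸_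
  -- `prec` recurses on its first argument, but truncated subtraction recurses on the subtrahend.
  ∸-computable = flip-computable (primrec₂ (unary (var 0F) λ _ → refl)
    (ap₁ pred-computable (var 1F)) λ y x → ℕₚ.pred[m∸n]≡m∸[1+n] x y)

oracle-computable : ∀ {A} → A ≤T A
oracle-computable = oracle , λ _ → oracle⇓

⊕-odd : ∀ A B n → (A ⊕ B) (suc (n + n)) ≡ B n
⊕-odd A B zero    = refl
⊕-odd A B (suc n) rewrite ℕₚ.+-suc n n = ⊕-odd (A ∘ suc) (B ∘ suc) n

⊕-computesʳ : ∀ A B → B ≤T A ⊕ B
⊕-computesʳ A B = unary
  (ap₁ oracle-computable (ap₁ suc-computable (ap₂ +-computable (var 0F) (var 0F))))
  (⊕-odd A B)

-- Transfer from the zero oracle to an arbitrary oracle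

mutual
  -- The order of a presentation is computable with the zero oracle, whereas the reduction runs with
  -- other oracles. Under the zero oracle every query returns 0, so a query may be replaced by that
  -- constant.
  deoracle : ∀ {n} → Code n → Code n
  deoracle zer         = zer
  deoracle succ        = succ
  deoracle oracle      = comp zer []
  deoracle (proj i)    = proj i
  deoracle (comp f gs) = comp (deoracle f) (deoracle* gs)
  deoracle (prec f g)  = prec (deoracle f) (deoracle g)
  deoracle (mu f)      = mu (deoracle f)

  deoracle* : ∀ {m n} → Vec (Code n) m → Vec (Code n) m
  deoracle* []       = []
  deoracle* (g ∷ gs) = deoracle g ∷ deoracle* gs

lookup-deoracle* : ∀ {m n} (gs : Vec (Code n) m) i → lookup (deoracle* gs) i ≡ deoracle (lookup gs i)
lookup-deoracle* (g ∷ gs) zero    = refl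
lookup-deoracle* (g ∷ gs) (suc i) = lookup-deoracle* gs i

deoracle⇓ : ∀ {A n} {e : Code n} {xs y} → (λ _ → 0) ⊢ e [ xs ]⇓ y → A ⊢ deoracle e [ xs ]⇓ y
deoracle⇓ zer⇓    = zer⇓
deoracle⇓ succ⇓   = succ⇓
deoracle⇓ oracle⇓ = comp⇓ {ys = []} (λ ()) zer⇓
deoracle⇓ proj⇓   = proj⇓
deoracle⇓ {A} (comp⇓ {gs = gs} ds d) = comp⇓
  (λ i → subst (λ e → A ⊢ e [ _ ]⇓ _) (sym (lookup-deoracle* gs i)) (deoracle⇓ (ds i)))
  (deoracle⇓ d)
deoracle⇓ (prec0⇓ d)   = prec0⇓ (deoracle⇓ d)
deoracle⇓ (precs⇓ d e) = precs⇓ (deoracle⇓ d) (deoracle⇓ e)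
deoracle⇓ (mu⇓ d ds)   = mu⇓ (deoracle⇓ d) λ z z<y → proj₁ (ds z z<y) , deoracle⇓ (proj₂ (ds z z<y))

bit-not : ∀ b → 1 ∸ bit b ≡ bit (not b)
bit-not false = refl
bit-not true  = refl

bit-∧ : ∀ a b → bit a * bit b ≡ bit (a ∧ b)
bit-∧ false b     = refl
bit-∧ true  false = refl
bit-∧ true  true  = refl

-- The enumeration of pairs

-- triangle y is the number of pairs with larger element below y.
triangle : ℕ → ℕ
triangle zero    = 0
triangle (suc y) = triangle y + y

-- The pairs with larger element `y` occupy a block of `y` consecutive indices starting at
-- `triangle y`, ordered by their smaller element.
pairAt-index : ∀ n → triangle (hi (pairAt n)) + lo (pairAt n) ≡ n
pairAt-index zero    = refl
pairAt-index (suc n) with pairAt n | pairAt-index n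
... | pair x y x<y | eq with suc x ℕₚ.<? y
...   | yes _   = trans (ℕₚ.+-suc (triangle y) x) (cong suc eq)
...   | no sx≮y = begin
  triangle y + y + 0  ≡⟨ ℕₚ.+-identityʳ _ ⟩
  -- From `x < y` and the failure of `suc x < y` follows `y ≡ suc x`: the block of `y` ends here.
  triangle y + y      ≡⟨ cong (triangle y +_) (ℕₚ.≤-antisym (ℕₚ.≮⇒≥ sx≮y) (recompute (x ℕₚ.<? y) x<y)) ⟩
  triangle y + suc x  ≡⟨ ℕₚ.+-suc (triangle y) x ⟩
  suc (triangle y + x) ≡⟨ cong suc eq ⟩
  suc n ∎
  where open ≡-Reasoning

-- The larger element grows exactly when `suc n` reaches `triangle (suc y)`, where the next block
-- starts. The nested `∸` is the arithmetic form of this test.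
hi-pairAt-suc : ∀ n → let y = hi (pairAt n) in
                y + (1 ∸ (triangle (suc y) ∸ suc n)) ≡ hi (pairAt (suc n))
hi-pairAt-suc n with pairAt n | pairAt-index n
... | pair x y _ | refl with suc x ℕₚ.<? y
...   | yes sx<y = trans (cong (y +_) (ℕₚ.m≤n⇒m∸n≡0 (ℕₚ.m<n⇒0<n∸m
                     (subst (_< triangle y + y) (ℕₚ.+-suc (triangle y) x)
                       (ℕₚ.+-monoʳ-< (triangle y) sx<y))))) (ℕₚ.+-identityʳ y)
...   | no sx≮y  = trans (cong (λ d → y + (1 ∸ d)) (ℕₚ.m≤n⇒m∸n≡0
                     (subst (triangle y + y ≤_) (ℕₚ.+-suc (triangle y) x)
                       (ℕₚ.+-monoʳ-≤ (triangle y) (ℕₚ.≮⇒≥ sx≮y))))) (ℕₚ.+-comm y 1)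

module _ {A : ℕ → ℕ} where

  triangle-computable : triangle ≤T A
  triangle-computable = primrec₁ (ap₂ +-computable (var 1F) (var 0F)) λ _ → refl

  hi-pairAt-computable : (λ n → hi (pairAt n)) ≤T A
  hi-pairAt-computable = primrec₁
    (ap₂ +-computable (var 1F)
      (ap₂ ∸-computable (const-computable 1)
        (ap₂ ∸-computable (ap₁ triangle-computable (ap₁ suc-computable (var 1F)))
                          (ap₁ suc-computable (var 0F)))))
    hi-pairAt-suc

  lo-pairAt-computable : (λ n → lo (pairAt n)) ≤T A
  lo-pairAt-computable = unary
    (ap₂ ∸-computable (var 0F) (ap₁ triangle-computable (ap₁ hi-pairAt-computable (var 0F))))
    λ n → trans (cong (_∸ triangle (hi (pairAt n))) (sym (pairAt-index n)))
                (ℕₚ.m+n∸m≡n (triangle (hi (pairAt n))) _)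

module _ {A : Set} {_≺_ : Rel A 0ℓ} (cmp : Trichotomous _≡_ _≺_) where

  unordered-< : ∀ {x y} .(x≢y : x ≢ y) (x≺y : x ≺ y) → unordered cmp x y x≢y ≡ pair x y x≺y
  unordered-< {x} {y} _ x≺y with cmp x y
  ... | tri< _ _ _    = refl
  ... | tri≈ x⊀y _ _  = contradiction x≺y x⊀y
  ... | tri> x⊀y _ _  = contradiction x≺y x⊀y

  unordered-> : ∀ {x y} .(x≢y : x ≢ y) (y≺x : y ≺ x) → unordered cmp x y x≢y ≡ pair y x y≺x
  unordered-> {x} {y} _ y≺x with cmp x y
  ... | tri< _ _ y⊀x = contradiction y≺x y⊀x
  ... | tri≈ _ _ y⊀x = contradiction y≺x y⊀x
  ... | tri> _ _ _   = refl

-- Records (left-to-right maxima)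

module Records (s : ℕ → Bool) {_≺_ : Rel ℕ 0ℓ} (_≺?_ : Decidable _≺_) where

  -- Recursion on the bound `m` makes the test primitive recursive. The last factor encodes the
  -- implication from `s m` to `m ≺ n`.
  above : ℕ → ℕ → Bool
  above zero    n = true
  above (suc m) n = above m n ∧ not (s m ∧ not (does (m ≺? n)))

  isRecord : ℕ → Bool
  isRecord n = s n ∧ above n n

  above-sound : ∀ m {n p} → T (above m n) → p < m → T (s p) → p ≺ n
  above-sound (suc m) {n} {p} t p<1+m sp with Equivalence.to (T-∧ {above m n}) t | p ℕₚ.≟ m
  ... | t′ , _ | no p≢m   = above-sound m t′ (ℕₚ.≤∧≢⇒< (ℕₚ.≤-pred p<1+m) p≢m) sp
  ... | _ , u  | yes refl with s m | m ≺? n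
  ...   | true | yes m≺n = m≺n

  above-complete : ∀ m {n} → (∀ p → p < m → T (s p) → p ≺ n) → T (above m n)
  above-complete zero    h = _
  above-complete (suc m) {n} h = Equivalence.from (T-∧ {above m n})
    (above-complete m (λ p p<m → h p (ℕₚ.m<n⇒m<1+n p<m)) , last)
    where
    last : T (not (s m ∧ not (does (m ≺? n))))
    -- Abstracting `h m` as well turns its premise `T (s m)` into a trivial one in the last case.
    last with s m | m ≺? n | h m (ℕₚ.n<1+n m)
    ... | false | _       | _ = _
    ... | true  | yes _   | _ = _
    ... | true  | no m⊀n  | k = m⊀n (k _)

  record⇒member : ∀ {n} → T (isRecord n) → T (s n)
  record⇒member {n} = proj₁ ∘ Equivalence.to (T-∧ {s n})

  -- All pairs of records thus share one direction, which fixes the bit of their colour.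
  records-increasing : ∀ {m n} → m < n → T (isRecord m) → T (isRecord n) → m ≺ n
  records-increasing {m} {n} m<n rm rn =
    above-sound n (proj₂ (Equivalence.to (T-∧ {s n}) rn)) m<n (record⇒member rm)

  isRecord-computable : ∀ {A} → (bit ∘ s) ≤T A →
    Computable₂ A (λ m n → bit (does (m ≺? n))) → (bit ∘ isRecord) ≤T A
  isRecord-computable {A} s≤A ≺≤A = unary
    (ap₂ *-computable (ap₁ s≤A (var 0F)) (ap₂ above≤A (var 0F) (var 0F)))
    (λ n → bit-∧ (s n) (above n n))
    where
    complement : ∀ {n} {F : Vec ℕ n → ℕ} → Computable A F → Computable A (λ xs → 1 ∸ F xs)
    complement = ap₂ ∸-computable (const-computable 1)

    step : ∀ m n → bit (above m n) * (1 ∸ bit (s m) * (1 ∸ bit (does (m ≺? n)))) ≡ bit (above (suc m) n)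
    step m n
      rewrite bit-not (does (m ≺? n))
            | bit-∧ (s m) (not (does (m ≺? n)))
            | bit-not (s m ∧ not (does (m ≺? n)))
            = bit-∧ (above m n) _

    above≤A : Computable₂ A (λ m n → bit (above m n))
    above≤A = primrec₂ (unary (const-computable 1) λ _ → refl)
      -- Here `0F` is `m`, `1F` is the value already found for `m`, and `2F` is `n`.
      (ap₂ *-computable (var 1F)
        (complement (ap₂ *-computable (ap₁ s≤A (var 0F))
                                      (complement (ap₂ ≺≤A (var 0F) (var 2F))))))
      step

  -- These properties hold for `<` on the rationals and for its reverse, so maxima and minima share
  -- one argument. Linearity enters through `≺-cotrans`.
  module _ (≺-cotrans   : ∀ {p b n} → p ≺ b → ¬ (n ≺ b) → p ≺ n)
           (≺-irrefl    : ∀ {n} → ¬ (n ≺ n))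
           (≺-trans     : ∀ {p n b} → p ≺ n → n ≺ b → p ≺ b)
           (inhabited   : ∃[ b ] T (s b))
           (noGreatest  : ∀ n → T (s n) → ∃[ b ] T (s b) × n ≺ b)
    where

    Bounds : ℕ → ℕ → Set
    Bounds n b = ∀ p → p < n → T (s p) → p ≺ b

    Bounds-suc : ∀ {n b} → Bounds n b → (T (s n) → n ≺ b) → Bounds (suc n) b
    Bounds-suc {n} h k p p<1+n sp with p ℕₚ.≟ n
    ... | yes refl = k sp
    ... | no p≢n   = h p (ℕₚ.≤∧≢⇒< (ℕₚ.≤-pred p<1+n) p≢n) sp

    -- Such a bound gives the search for a record an end. If the old bound fails for the member `n`,
    -- then `n` lies above all earlier members, and `noGreatest` yields a member above `n`.
    bounded : ∀ n → ∃[ b ] T (s b) × Bounds n b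
    bounded zero    = proj₁ inhabited , proj₂ inhabited , λ _ ()
    bounded (suc n) with bounded n | n ≺? proj₁ (bounded n) | s n in eq
    ... | b , sb , h | yes n≺b | _     = b , sb , Bounds-suc h (λ _ → n≺b)
    ... | b , sb , h | no _    | false = b , sb , Bounds-suc h (λ sn → contradiction (subst T eq sn) λ ())
    ... | b , sb , h | no n⊀b  | true  =
      let c , sc , n≺c = noGreatest n (Equivalence.from T-≡ eq)
      in c , sc , Bounds-suc (λ p p<n sp → ≺-trans (≺-cotrans (h p p<n sp) n⊀b) n≺c) (λ _ → n≺c)

    -- A bound b of the members below n either is a record itself or is
    -- preceded by a member n ≤ m < b not below b, the first of which is a record.
    record-above : ∀ d n {b} → n + d ≡ b → T (s b) → Bounds n b → ∃[ m ] n ≤ m × T (isRecord m)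
    record-above zero    n refl sb h rewrite ℕₚ.+-identityʳ n =
      n , ℕₚ.≤-refl , Equivalence.from (T-∧ {s n}) (sb , above-complete n h)
    record-above (suc d) n {b} eq sb h with n ≺? b | s n in sn
    -- The earlier members lie below `b` and `n` does not, so they lie below `n`.
    ... | no n⊀b | true =
      n , ℕₚ.≤-refl , Equivalence.from (T-∧ {s n})
        (Equivalence.from T-≡ sn , above-complete n (λ p p<n sp → ≺-cotrans (h p p<n sp) n⊀b))
    ... | yes n≺b | _ =
      let m , n<m , r = record-above d (suc n) (trans (sym (ℕₚ.+-suc n d)) eq) sb (Bounds-suc h (λ _ → n≺b))
      in m , ℕₚ.<⇒≤ n<m , r
    ... | no _ | false =
      let m , n<m , r = record-above d (suc n) (trans (sym (ℕₚ.+-suc n d)) eq) sb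
                          (Bounds-suc h (λ t → contradiction (subst T sn t) λ ()))
      in m , ℕₚ.<⇒≤ n<m , r

    records-infinite : Infinite isRecord
    records-infinite n with bounded n
    ... | b , sb , h with n ℕₚ.≤? b
    ...   | yes n≤b = record-above (b ∸ n) n (ℕₚ.m+[n∸m]≡n n≤b) sb h
    -- If `b < n`, then `b` would be among the members that it bounds.
    ...   | no n≰b  = contradiction (h b (ℕₚ.≰⇒> n≰b) sb) ≺-irrefl

-- Splitting the colours

∣++∣ : ∀ {m n} (p : Subset m) (q : Subset n) → ∣ p ++ q ∣ ≡ ∣ p ∣ + ∣ q ∣
∣++∣ []          q = refl
∣++∣ (true ∷ p)  q = cong suc (∣++∣ p q)
∣++∣ (false ∷ p) q = ∣++∣ p q

-- Pigeonhole: two numbers exceeding `ℓ` add up to at least `2 * ℓ + 2`.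
halve : ∀ {a b ℓ} → a + b ≤ 2 * ℓ + 1 → a ≤ ℓ ⊎ b ≤ ℓ
halve {a} {b} {ℓ} a+b≤ with a ℕₚ.≤? ℓ | b ℕₚ.≤? ℓ
... | yes a≤ℓ | _       = inj₁ a≤ℓ
... | no _    | yes b≤ℓ = inj₂ b≤ℓ
... | no a≰ℓ  | no b≰ℓ  = contradiction (ℕₚ.≤-trans (ℕₚ.+-mono-≤ (ℕₚ.≰⇒> a≰ℓ) (ℕₚ.≰⇒> b≰ℓ)) a+b≤)
                            (ℕₚ.<⇒≱ (ℕₚ.≤-reflexive eq))
  where
  open ≡-Reasoning
  eq : suc (2 * ℓ + 1) ≡ suc ℓ + suc ℓ
  eq = begin
    suc (2 * ℓ + 1)       ≡⟨ cong suc (ℕₚ.+-comm (2 * ℓ) 1) ⟩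
    suc (suc (ℓ + (ℓ + 0))) ≡⟨ cong (λ x → suc (suc (ℓ + x))) (ℕₚ.+-identityʳ ℓ) ⟩
    suc (suc (ℓ + ℓ))     ≡⟨ cong suc (ℕₚ.+-suc ℓ ℓ) ⟨
    suc ℓ + suc ℓ         ∎

-- `combine` arranges the colours in two blocks of length `k`, one for each value of the bit, so the
-- halves of the vector `C` can be counted separately.
half-colours : ∀ {k ℓ} (C : Subset (2 * k)) → ∣ C ∣ ≤ 2 * ℓ + 1 →
               Σ[ b ∈ Fin 2 ] Card≤ (λ (c : Fin k) → combine b c ∈ C) ℓ
half-colours {k} {ℓ} C ∣C∣≤ with splitAt k C
-- `2 * k` unfolds to `k + (k + 0)`; this split removes the empty tail.
... | C₀ , C₁′ , refl with splitAt k C₁′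
... | C₁ , [] , refl with halve {∣ C₀ ∣} {∣ C₁ ∣} ∣C∣≤′
  where
  ∣C∣≤′ : ∣ C₀ ∣ + ∣ C₁ ∣ ≤ 2 * ℓ + 1
  ∣C∣≤′ = subst (_≤ 2 * ℓ + 1)
    (trans (∣++∣ C₀ (C₁ ++ [])) (cong (∣ C₀ ∣ +_) (trans (∣++∣ C₁ []) (ℕₚ.+-identityʳ _)))) ∣C∣≤
... | inj₁ C₀≤ℓ = 0F , C₀ , C₀≤ℓ , λ c c∈C →
  lookup⇒[]= c C₀ (trans (sym (lookup-++ˡ C₀ (C₁ ++ []) c)) ([]=⇒lookup c∈C))
-- `combine 1F c` unfolds to `k ↑ʳ (c ↑ˡ 0)`, hence the two lookups.
... | inj₂ C₁≤ℓ = 1F , C₁ , C₁≤ℓ , λ c c∈C →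
  lookup⇒[]= c C₁ (trans (sym (trans (lookup-++ʳ C₀ (C₁ ++ []) (c ↑ˡ 0)) (lookup-++ˡ C₁ [] c)))
                         ([]=⇒lookup c∈C))

-- The reduction

module Reduction (𝒬 : ComputablePresentation) {k : ℕ} (f : Pairs _<_ → Fin k) where

  open ComputablePresentation 𝒬
  open Bijection enum using (injective; to⁻; strictlySurjective)

  to∘to⁻ : ∀ q → ν (to⁻ q) ≡ q
  to∘to⁻ = proj₂ ∘ strictlySurjective

  to⁻∘to : ∀ i → to⁻ (ν i) ≡ i
  to⁻∘to i = injective (to∘to⁻ (ν i))

  to⁻-≢ : ∀ {x y} → x <ℚ y → to⁻ x ≢ to⁻ y
  to⁻-≢ {x} {y} x<y eq = ℚₚ.<-irrefl (trans (sym (to∘to⁻ x)) (trans (cong ν eq) (to∘to⁻ y))) x<y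

  -- Pairs of rationals are listed by increasing value, so comparing their indices tells whether the
  -- two orders agree; `0F` stands for agreement.
  direction : ℕ → ℕ → Fin 2
  direction i j = if does (i ℕₚ.<? j) then 0F else 1F

  colouring : Pairs _<ℚ_ → Fin (2 * k)
  colouring (pair x y x<y) =
    combine (direction (to⁻ x) (to⁻ y)) (f (unordered ℕₚ.<-cmp (to⁻ x) (to⁻ y) (to⁻-≢ x<y)))

  colouring-ν : ∀ {i j} .(νi<νj : ν i <ℚ ν j) .(i≢j : i ≢ j) → colouring (pair (ν i) (ν j) νi<νj) ≡
                combine (direction i j) (f (unordered ℕₚ.<-cmp i j i≢j))
  colouring-ν {i} {j} νi<νj i≢j = go (to⁻∘to i) (to⁻∘to j) (to⁻-≢ νi<νj)
    where
    -- `to⁻ (ν i)` equals `i` only propositionally; with variables in its place the equations can be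
    -- matched.
    go : ∀ {i′ j′} → i′ ≡ i → j′ ≡ j → .(i′≢j′ : i′ ≢ j′) →
         combine (direction i′ j′) (f (unordered ℕₚ.<-cmp i′ j′ i′≢j′)) ≡
         combine (direction i j) (f (unordered ℕₚ.<-cmp i j i≢j))
    go refl refl _ = refl

  colouring-ascent : ∀ {i j} (i<j : i < j) .(νi<νj : ν i <ℚ ν j) →
                     colouring (pair (ν i) (ν j) νi<νj) ≡ combine {2} 0F (f (pair i j i<j))
  colouring-ascent {i} {j} i<j νi<νj = trans (colouring-ν νi<νj (ℕₚ.<⇒≢ i<j))
    (cong₂ (combine {2}) (cong (if_then 0F else 1F) (dec-true (i ℕₚ.<? j) i<j))
                   (cong f (unordered-< ℕₚ.<-cmp _ i<j)))

  colouring-descent : ∀ {i j} (i<j : i < j) .(νj<νi : ν j <ℚ ν i) →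
                      colouring (pair (ν j) (ν i) νj<νi) ≡ combine {2} 1F (f (pair i j i<j))
  colouring-descent {i} {j} i<j νj<νi = trans (colouring-ν νj<νi (ℕₚ.>⇒≢ i<j))
    (cong₂ (combine {2}) (cong (if_then 0F else 1F) (dec-false (j ℕₚ.<? i) (ℕₚ.<-asym i<j)))
                   (cong f (unordered-> ℕₚ.<-cmp _ i<j)))

  _<ν?_ : Decidable (_<ℚ_ on ν)
  i <ν? j = ν i ℚₚ.<? ν j

  <ν-computable : ∀ {A} → Computable₂ A (λ i j → bit (does (i <ν? j)))
  <ν-computable = deoracle (proj₁ <-computable) , λ i j → deoracle⇓ (proj₂ <-computable i j)

  -- This arithmetic form of the colour needs only the indices, their order in the presentation and
  -- `f p`, so the colouring is computed without inverting `ν`.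
  colouring-toℕ : ∀ p → (1 ∸ bit (does (lo p <ν? hi p))) * k + toℕ (f p) ≡ toℕ (colouring (ν-pair p))
  colouring-toℕ (pair i j i<j′) with recompute (i ℕₚ.<? j) i<j′ | ℚₚ.<-cmp (ν i) (ν j)
  ... | i<j | tri< νi<νj _ _ = begin
    (1 ∸ bit (does (i <ν? j))) * k + toℕ (f (pair i j i<j))
      ≡⟨ cong (λ b → (1 ∸ bit b) * k + _) (dec-true (i <ν? j) νi<νj) ⟩
    toℕ (f (pair i j i<j))
      ≡⟨ cong (_+ toℕ (f (pair i j i<j))) (ℕₚ.*-zeroʳ k) ⟨
    k * 0 + toℕ (f (pair i j i<j))
      ≡⟨ toℕ-combine {2} 0F (f (pair i j i<j)) ⟨
    toℕ (combine {2} 0F (f (pair i j i<j)))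
      ≡⟨ cong toℕ (colouring-ascent i<j νi<νj) ⟨
    toℕ (colouring (pair (ν i) (ν j) νi<νj)) ∎
    where open ≡-Reasoning
  ... | i<j | tri≈ _ νi≡νj _ = contradiction (injective νi≡νj) (ℕₚ.<⇒≢ i<j)
  ... | i<j | tri> νi≮νj _ νj<νi = begin
    (1 ∸ bit (does (i <ν? j))) * k + toℕ (f (pair i j i<j))
      ≡⟨ cong (λ b → (1 ∸ bit b) * k + _) (dec-false (i <ν? j) νi≮νj) ⟩
    1 * k + toℕ (f (pair i j i<j))
      ≡⟨ cong (_+ toℕ (f (pair i j i<j))) (ℕₚ.*-comm 1 k) ⟩
    k * 1 + toℕ (f (pair i j i<j))
      ≡⟨ toℕ-combine {2} 1F (f (pair i j i<j)) ⟨
    toℕ (combine {2} 1F (f (pair i j i<j)))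
      ≡⟨ cong toℕ (colouring-descent i<j νj<νi) ⟨
    toℕ (colouring (pair (ν j) (ν i) νj<νi)) ∎
    where open ≡-Reasoning

  colouring-computable : (λ n → toℕ (colouring (ν-pair (pairAt n)))) ≤T (λ n → toℕ (f (pairAt n)))
  colouring-computable = unary
    (ap₂ +-computable
      (ap₂ *-computable
        (ap₂ ∸-computable (const-computable 1)
          (ap₂ <ν-computable (ap₁ lo-pairAt-computable (var 0F)) (ap₁ hi-pairAt-computable (var 0F))))
        (const-computable k))
      -- Both colourings code a pair of indices by the same `n`, so the oracle for `f` is queried at
      -- `n` itself.
      (ap₁ oracle-computable (var 0F)))
    (λ n → colouring-toℕ (pairAt n))

  -- Maxima and minima of a dense set without endpoints

  module _ {S : ℚ → Bool} (dense : DenseWithoutEndpoints S) where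

    open DenseWithoutEndpoints dense

    index : ((q , _) : Members S) → T (S (ν (to⁻ q)))
    index (q , t) = subst (T ∘ S) (sym (to∘to⁻ q)) t

    module Maxima = Records (S ∘ ν) _<ν?_
    module Minima = Records (S ∘ ν) (flip _<ν?_)

    maxima-infinite : Infinite Maxima.isRecord
    maxima-infinite = Maxima.records-infinite
      (λ p<b n≮b → ℚₚ.<-≤-trans p<b (ℚₚ.≮⇒≥ n≮b)) (ℚₚ.<-irrefl refl) ℚₚ.<-trans
      (to⁻ (proj₁ nonempty) , index nonempty)
      λ n t → let y , n<y = noGreatest (ν n , t)
              in to⁻ (proj₁ y) , index y , subst (ν n <ℚ_) (sym (to∘to⁻ _)) n<y

    minima-infinite : Infinite Minima.isRecord
    minima-infinite = Minima.records-infinite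
      (λ b<p b≮n → ℚₚ.≤-<-trans (ℚₚ.≮⇒≥ b≮n) b<p) (ℚₚ.<-irrefl refl) (flip ℚₚ.<-trans)
      (to⁻ (proj₁ nonempty) , index nonempty)
      λ n t → let y , y<n = noLeast (ν n , t)
              in to⁻ (proj₁ y) , index y , subst (_<ℚ ν n) (sym (to∘to⁻ _)) y<n

    -- On maxima, values increase with indices, so each colour of `f` reappears on `S` with bit
    -- `0F`; a bound on that half of the colours of `S` then bounds those of `f`.
    maxima-colours : ∀ {c} → Image f Maxima.isRecord c → Image colouring S (combine {2} 0F c)
    maxima-colours (pair i j i<j′ , ri , rj , refl) =
      let i<j   = recompute (i ℕₚ.<? j) i<j′
          νi<νj = Maxima.records-increasing i<j ri rj
      in pair (ν i) (ν j) νi<νj , Maxima.record⇒member ri , Maxima.record⇒member rj ,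
         colouring-ascent i<j νi<νj

    minima-colours : ∀ {c} → Image f Minima.isRecord c → Image colouring S (combine {2} 1F c)
    minima-colours (pair i j i<j′ , ri , rj , refl) =
      let i<j   = recompute (i ℕₚ.<? j) i<j′
          νj<νi = Minima.records-increasing i<j ri rj
      -- The later minimum has the smaller value, so the pair is listed in reverse and gets bit
      -- `1F`.
      in pair (ν j) (ν i) νj<νi , Minima.record⇒member rj , Minima.record⇒member ri ,
         colouring-descent i<j νj<νi

theorem5p28 : (𝒬 : ComputablePresentation) (k ℓ : ℕ) → 1 ≤ k → 1 ≤ ℓ →
    RT² k ℓ ≤c DT² 𝒬 (2 * k) (2 * ℓ + 1)
theorem5p28 𝒬 k ℓ _ _ f = colouring , colouring-computable , solve
  where
  open ComputablePresentation 𝒬 using (ν)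
  open Reduction 𝒬 f

  solve : ∀ S → DenseWithoutEndpoints S × Card≤ (Image colouring S) (2 * ℓ + 1) →
    Σ[ H ∈ (ℕ → Bool) ] (Infinite H × Card≤ (Image f H) ℓ) ×
      ((bit ∘ H) ≤T ((λ n → toℕ (f (pairAt n))) ⊕ (λ n → bit (S (ν n)))))
  -- The choice between maxima and minima depends on `C`, which the oracle need not reveal.
  -- Computable reducibility allows this, since the program may vary with the solution.
  solve S (dense , C , ∣C∣≤ , image⊆C) with half-colours {k} C ∣C∣≤
  ... | 0F , D , ∣D∣≤ , ⊆D =
    isRecord , (maxima-infinite dense , D , ∣D∣≤ , λ c → ⊆D c ∘ image⊆C _ ∘ maxima-colours dense) ,
    isRecord-computable (⊕-computesʳ _ _) <ν-computable
    where open Maxima dense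
  ... | 1F , D , ∣D∣≤ , ⊆D =
    isRecord , (minima-infinite dense , D , ∣D∣≤ , λ c → ⊆D c ∘ image⊆C _ ∘ minima-colours dense) ,
    isRecord-computable (⊕-computesʳ _ _) (flip-computable <ν-computable)
    where open Minima dense
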